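{- There exist positive constants $c_1$ and $c_2$ such that for all integers $a\geq 2$ and $q\geq 4a^2\log a$, \[ 2q+c_1a\sqrt{q\log a}\leq \chi_{sc}(K_{a,q})\leq 2q+c_2a\sqrt{q\log a}. \]
   Context: $K_{a,q}$ is the complete bipartite graph with parts of sizes $a$ and $q$. For a graph $G=(V,E)$ and $f:V\to\mathbb{N}$, an $f$-assignment is an assignment of color lists $L(v)$ with $|L(v)|=f(v)$; $G$ is $f$-choosable if for every $f$-assignment $L$ there is a proper coloring $c$ with $c(v)\in L(v)$ for all $v$. The sum choice number $\chi_{sc}(G)$ is the minimum of $\sum_{v\in V}f(v)$ over all $f$ such that $G$ is $f$-choosable. -}

module Defs where

open import Data.Nat using (ℕ; zero; suc; _+_; _*_; _^_; _≤_; _<_; _!)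
open import Data.Bool using (Bool; true; false)
open import Data.Fin using (Fin; splitAt)
open import Data.Sum using (inj₁; inj₂)
open import Data.List using (List; length; map; allFin)
open import Data.Nat.ListAction using (sum)
open import Data.List.Membership.Propositional using (_∈_)
open import Data.List.Relation.Unary.Unique.Propositional using (Unique)
open import Data.Product using (Σ; ∃; _×_)
open import Relation.Binary.PropositionalEquality using (_≡_; _≢_)

record Graph : Set₁ where
  field
    n   : ℕ
    Adj : Fin n → Fin n → Set
open Graph public

leftSide : (a : ℕ) {q : ℕ} → Fin (a + q) → Bool
leftSide a v with splitAt a v
... | inj₁ _ = true
... | inj₂ _ = false

K : ℕ → ℕ → Graph
K a q = record { n = a + q ; Adj = λ u v → leftSide a u ≢ leftSide a v }

record Assignment (G : Graph) (f : Fin (n G) → ℕ) : Set where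
  field
    L    : Fin (n G) → List ℕ
    uniq : ∀ v → Unique (L v)
    len  : ∀ v → length (L v) ≡ f v
open Assignment public

ProperLColoring : (G : Graph) → (Fin (n G) → List ℕ) → Set
ProperLColoring G L =
  Σ (Fin (n G) → ℕ) λ c → (∀ v → c v ∈ L v) × (∀ u v → Adj G u v → c u ≢ c v)

Choosable : (G : Graph) → (Fin (n G) → ℕ) → Set
Choosable G f = (A : Assignment G f) → ProperLColoring G (L A)

weight : (G : Graph) → (Fin (n G) → ℕ) → ℕ
weight G f = sum (map f (allFin (n G)))

IsSumChoiceNumber : Graph → ℕ → Set
IsSumChoiceNumber G s =
  (∃ λ f → Choosable G f × weight G f ≡ s) × (∀ f → Choosable G f → s ≤ weight G f)

-- expT M k = k! * Σ_{j ≤ k} M^j / j!   (scaled partial sum of the series of e^M)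
expT : ℕ → ℕ → ℕ
expT M zero = 1
expT M (suc k) = suc k * expT M k + M ^ suc k

-- A ≤ e^M  (real exponential), i.e. A ≤ sup_k S_k(M):
-- for every m, some partial sum S_k(M) exceeds A - 1/(m+1)
_≤exp_ : ℕ → ℕ → Set
A ≤exp M = ∀ m → ∃ λ k → suc m * ((k !) * A) < suc m * expT M k + k !

-- e^M ≤ A, i.e. every partial sum S_k(M) ≤ A
exp_≤_ : ℕ → ℕ → Set
exp M ≤ A = ∀ k → expT M k ≤ (k !) * A

{-# OPTIONS --safe #-}
-- Since 2 ≤ e² and e ≤ 4, all logarithms may be taken to base 2; let t be about log₂ a.
--
-- Lower bound: if q₁ vertices of the large side have lists of size 1, these can forbid q₁ colours, so
-- every list on the small side has more than q₁ colours; hence small lists on the large side do not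
-- pay, and the excess over 2q dominates both half the total size on the small side and the number
-- of lists of size at least 3 on the large side.  If the latter is at most q/2, colour pairs forming
-- t disjoint copies of K_{h,h} with t h² ≈ q/2 defeat any 2ᵗ lists of size at most t h ≈ √(tq/2).
--
-- Upper bound: lists of size r ≈ √(qt) on the small side and 2 on the large side suffice.  The latter
-- are edges of a graph on the colours, and an independent set meeting all lists of the small side
-- is found greedily, by always taking the colour with the most unsatisfied lists per incident edge;
-- when j lists remain it costs O(q/(jr)) colours per satisfied list, and the harmonic sum is O(t).
module Submission where

open import Defs
open import Data.Nat
open import Data.Nat.Properties
open import Data.Nat.DivMod using (_/_; m≡m%n+[m/n]*n; m%n<n; m/n*n≤m; /-monoʳ-≤)
import Data.Nat.ListAction as ListAction
open import Data.Nat.Tactic.RingSolver using (solve-∀)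
open import Data.Bool using (true; false)
open import Data.Empty using (⊥)
open import Data.Fin using (Fin; zero; suc; toℕ; splitAt; _↑ˡ_; _↑ʳ_; combine; remQuot; finToFun; funToFin)
import Data.Fin.Properties as Fin
open import Data.Maybe as Maybe using (Maybe; just; nothing; maybe′)
open import Data.List using (List; []; _∷_; _++_; length; map; concat; filter; allFin; take; upTo; tabulate)
open import Data.List.Properties
  using (length-take; length-upTo; length-map; length-++; length-tabulate; map-tabulate; filter-all; filter-accept; filter-reject)
open import Data.List.Membership.Propositional using (_∈_; _∉_)
open import Data.List.Membership.Propositional.Properties
  using (∈-map⁺; ∈-map⁻; ∈-++⁺ˡ; ∈-++⁺ʳ; ∈-++⁻; ∈-filter⁺; ∈-filter⁻; ∈-tabulate⁺; ∈-tabulate⁻)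
open import Data.List.Membership.DecPropositional _≟_ using (_∈?_)
open import Data.List.Relation.Unary.All as All using (All; []; _∷_)
import Data.List.Relation.Unary.All.Properties as All
open import Data.List.Relation.Unary.Any using (here; there)
open import Data.List.Relation.Unary.AllPairs using ([]; _∷_)
open import Data.List.Relation.Unary.Unique.Propositional using (Unique)
import Data.List.Relation.Unary.Unique.Propositional.Properties as Unique
open import Data.Product using (Σ; ∃; _×_; _,_; proj₁; proj₂; swap)
open import Data.Sum using (_⊎_; inj₁; inj₂; [_,_]′)
open import Function using (_∘_; id)
open import Relation.Nullary using (Dec; yes; no; ¬?; contradiction)
open import Relation.Binary.PropositionalEquality using (_≡_; _≢_; refl; sym; trans; cong; cong₂; subst)
open import Algebra.Properties.CommutativeMonoid.Sum +-0-commutativeMonoid using (sum; ∑-distrib-+; sum-cong-≗)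

open ≤-Reasoning

-- The exponential against powers of 2

-- The mean value inequality for the power `suc k` on a unit interval, with the derivative taken at
-- the right end.
suc-^-≤ : ∀ N k → suc N ^ suc k ≤ N ^ suc k + suc k * suc N ^ k
suc-^-≤ N zero = ≤-reflexive (lem N)
  where lem : ∀ N → suc N * 1 ≡ N * 1 + 1 * 1
        lem = solve-∀
suc-^-≤ N (suc k) = begin
  p + N * p                                ≤⟨ +-monoʳ-≤ p (*-monoʳ-≤ N (suc-^-≤ N k)) ⟩
  p + N * (N ^ suc k + suc k * suc N ^ k)  ≡⟨ lem p N (N ^ suc k) (suc k) (suc N ^ k) ⟩
  N * N ^ suc k + (p + suc k * (N * suc N ^ k))
    ≤⟨ +-monoʳ-≤ (N * N ^ suc k) (+-monoʳ-≤ p (*-monoʳ-≤ (suc k) (*-monoˡ-≤ (suc N ^ k) (n≤1+n N)))) ⟩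
  N * N ^ suc k + (p + suc k * p)          ∎
  where
    p = suc N ^ suc k
    lem : ∀ p N x k y → p + N * (x + k * y) ≡ N * x + (p + k * (N * y))
    lem = solve-∀

-- halfExp N k = 2ᵏ k! Σ_{j ≤ k} (N/2)ʲ/j!.  Halving the step is what makes the
-- increment absorbable: it gives S(x + 1/2) ≤ S(x) + S(x + 1/2)/2.
halfExp : ℕ → ℕ → ℕ
halfExp N zero = 1
halfExp N (suc k) = 2 * suc k * halfExp N k + N ^ suc k

-- The mean value inequality summed over the terms of the series, whose derivative is the shorter
-- partial sum. Divided by the scaling factor it reads `S_{k+1}(x + 1/2) ≤ S_{k+1}(x) + S_k(x + 1/2)
-- / 2` at `x = N/2`.
halfExp-increment : ∀ N k → halfExp (suc N) (suc k) ≤ halfExp N (suc k) + suc k * halfExp (suc N) k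
halfExp-increment N zero = ≤-reflexive (lem N)
  where lem : ∀ N → 2 * 1 * 1 + suc N * 1 ≡ 2 * 1 * 1 + N * 1 + 1 * 1
        lem = solve-∀
halfExp-increment N (suc k) = begin
  2 * j * halfExp (suc N) (suc k) + suc N ^ j
    ≤⟨ +-mono-≤ (*-monoʳ-≤ (2 * j) (halfExp-increment N k)) (suc-^-≤ N (suc k)) ⟩
  2 * j * (halfExp N (suc k) + suc k * halfExp (suc N) k) + (N ^ j + j * suc N ^ suc k)
    ≡⟨ lem j (halfExp N (suc k)) (suc k) (halfExp (suc N) k) (N ^ j) (suc N ^ suc k) ⟩
  halfExp N j + j * halfExp (suc N) (suc k) ∎
  where
    j = suc (suc k)
    lem : ∀ j x k y u v → 2 * j * (x + k * y) + (u + j * v) ≡ 2 * j * x + u + j * (2 * k * y + v)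
    lem = solve-∀

halfExp-double : ∀ N k → halfExp (suc N) k ≤ 2 * halfExp N k
halfExp-double N zero = s≤s z≤n
halfExp-double N (suc k) = +-cancelʳ-≤ y y (2 * x) (begin
  y + y                  ≤⟨ +-mono-≤ (halfExp-increment N k) (halfExp-increment N k) ⟩
  (x + z) + (x + z)      ≡⟨ lem x (suc k) (halfExp (suc N) k) ⟩
  -- By definition `y` is `2 * z` plus a power of `suc N`, so twice the increment fits into one copy
  -- of `y`.
  2 * x + 2 * suc k * halfExp (suc N) k ≤⟨ +-monoʳ-≤ (2 * x) (m≤m+n _ _) ⟩
  2 * x + y ∎)
  where
    x = halfExp N (suc k)
    y = halfExp (suc N) (suc k)
    z = suc k * halfExp (suc N) k
    lem : ∀ x k y → (x + k * y) + (x + k * y) ≡ 2 * x + 2 * k * y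
    lem = solve-∀

halfExp-zero : ∀ k → halfExp 0 k ≡ 2 ^ k * (k !)
halfExp-zero zero = refl
halfExp-zero (suc k) rewrite halfExp-zero k = lem (suc k) (2 ^ k) (k !)
  where lem : ∀ k x y → 2 * k * (x * y) + 0 ≡ 2 * x * (k * y)
        lem = solve-∀

halfExp-bound : ∀ N k → halfExp N k ≤ 2 ^ N * (2 ^ k * (k !))
halfExp-bound zero k = ≤-reflexive (trans (halfExp-zero k) (sym (*-identityˡ _)))
halfExp-bound (suc N) k = begin
  halfExp (suc N) k             ≤⟨ halfExp-double N k ⟩
  2 * halfExp N k               ≤⟨ *-monoʳ-≤ 2 (halfExp-bound N k) ⟩
  2 * (2 ^ N * (2 ^ k * (k !))) ≡⟨ sym (*-assoc 2 (2 ^ N) _) ⟩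
  2 ^ suc N * (2 ^ k * (k !))   ∎

halfExp-even : ∀ M k → halfExp (2 * M) k ≡ 2 ^ k * expT M k
halfExp-even M zero = refl
halfExp-even M (suc k) = trans
  (cong₂ _+_ (cong (2 * suc k *_) (halfExp-even M k)) (^-distribʳ-* (suc k) 2 M))
  (lem (suc k) (2 ^ k) (expT M k) (M ^ suc k))
  where
    ^-distribʳ-* : ∀ k m n → (m * n) ^ k ≡ m ^ k * n ^ k
    ^-distribʳ-* zero m n = refl
    ^-distribʳ-* (suc k) m n = trans (cong (m * n *_) (^-distribʳ-* k m n)) (l m n (m ^ k) (n ^ k))
      where l : ∀ m n x y → m * n * (x * y) ≡ m * x * (n * y)
            l = solve-∀
    lem : ∀ k p e m → 2 * k * (p * e) + 2 * p * m ≡ 2 * p * (k * e + m)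
    lem = solve-∀

-- This is `e ≤ 4`: each half step at most doubles the partial sum, and `M` is made of `2 * M` half
-- steps.
expT-≤ : ∀ M k → expT M k ≤ k ! * 2 ^ (2 * M)
expT-≤ M k = *-cancelˡ-≤ (2 ^ k) {{m^n≢0 2 k}} (begin
  2 ^ k * expT M k                   ≡⟨ sym (halfExp-even M k) ⟩
  halfExp (2 * M) k                  ≤⟨ halfExp-bound (2 * M) k ⟩
  2 ^ (2 * M) * (2 ^ k * (k !))      ≡⟨ lem (2 ^ (2 * M)) (2 ^ k) (k !) ⟩
  2 ^ k * (k ! * 2 ^ (2 * M))        ∎)
  where lem : ∀ x y z → x * (y * z) ≡ y * (z * x)
        lem = solve-∀

≤exp⇒≤2^ : ∀ {A M} → A ≤exp M → A ≤ 2 ^ (2 * M)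
-- Precision `m = 0` already gives `A < 1 + 2 ^ (2 * M)`, and integrality does the rest.
≤exp⇒≤2^ {A} {M} A≤ with A≤ 0
... | k , lt = s≤s⁻¹ (*-cancelˡ-< (k !) A (suc (2 ^ (2 * M))) (begin-strict
  k ! * A                       ≡⟨ sym (*-identityˡ _) ⟩
  1 * (k ! * A)                 <⟨ lt ⟩
  1 * expT M k + k !            ≡⟨ cong (_+ k !) (*-identityˡ (expT M k)) ⟩
  expT M k + k !                ≤⟨ +-monoˡ-≤ (k !) (expT-≤ M k) ⟩
  k ! * 2 ^ (2 * M) + k !       ≡⟨ +-comm _ (k !) ⟩
  k ! + k ! * 2 ^ (2 * M)       ≡⟨ sym (*-suc (k !) _) ⟩
  k ! * suc (2 ^ (2 * M)) ∎))

2^≤⇒exp≤ : ∀ {M A} → 2 ^ (2 * M) ≤ A → exp M ≤ A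
2^≤⇒exp≤ {M} p k = ≤-trans (expT-≤ M k) (*-monoʳ-≤ (k !) p)

-- The single term (2x)ˣ/x! of the series of e^{2x} already exceeds 2ˣ.
!*2^≤[2n]^ : ∀ n k → k ≤ n → k ! * 2 ^ k ≤ (2 * n) ^ k
!*2^≤[2n]^ n zero _ = s≤s z≤n
!*2^≤[2n]^ n (suc k) k<n = begin
  suc k * k ! * (2 * 2 ^ k)     ≡⟨ lem (suc k) (k !) (2 ^ k) ⟩
  2 * suc k * (k ! * 2 ^ k)     ≤⟨ *-mono-≤ (*-monoʳ-≤ 2 k<n) (!*2^≤[2n]^ n k (<⇒≤ k<n)) ⟩
  2 * n * (2 * n) ^ k ∎
  where lem : ∀ x y z → x * y * (2 * z) ≡ 2 * x * (y * z)
        lem = solve-∀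

^≤expT : ∀ M k → M ^ k ≤ expT M k
^≤expT M zero = ≤-refl
^≤expT M (suc k) = m≤n+m _ _

≤2^⇒≤exp : ∀ {A x} → A ≤ 2 ^ x → A ≤exp (2 * x)
≤2^⇒≤exp {A} {x} p m = x , (begin-strict
  suc m * (x ! * A)              ≤⟨ *-monoʳ-≤ (suc m) (≤-trans (*-monoʳ-≤ (x !) p) (≤-trans (!*2^≤[2n]^ x x ≤-refl) (^≤expT (2 * x) x))) ⟩
  suc m * expT (2 * x) x         <⟨ m<m+n _ (1≤n! x) ⟩
  suc m * expT (2 * x) x + x !   ∎)

-- Integer logarithms and square roots

dyadic : ∀ a → 2 ≤ a → ∃ λ t → 1 ≤ t × 2 * 2 ^ t ≤ a + 2 × a < 4 * 2 ^ t
dyadic (suc zero) (s≤s ())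
-- The lower inequality is an equality here: the slack of 2 in `a + 2` is what admits `t = 1`.
dyadic (suc (suc zero)) _ = 1 , ≤-refl , ≤-refl , m≤m+n 3 5
dyadic (suc a@(suc (suc _))) _ with dyadic a (s≤s (s≤s z≤n))
... | t , 1≤t , lower , upper with suc a <? 4 * 2 ^ t
...   | yes lt = t , 1≤t , m≤n⇒m≤1+n lower , lt
...   | no ≮ = suc t , s≤s z≤n ,
        (begin
          2 * (2 * 2 ^ t)   ≡⟨ sym (*-assoc 2 2 (2 ^ t)) ⟩
          4 * 2 ^ t         ≤⟨ ≮⇒≥ ≮ ⟩
          suc a             ≤⟨ m≤m+n (suc a) 2 ⟩
          suc a + 2         ∎) ,
        (begin-strict
          suc a             ≤⟨ upper ⟩
          4 * 2 ^ t         <⟨ m<m+n (4 * 2 ^ t) (*-mono-≤ (s≤s (z≤n {3})) (m^n>0 2 t)) ⟩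
          4 * 2 ^ t + 4 * 2 ^ t ≡⟨ lem (2 ^ t) ⟩
          4 * (2 * 2 ^ t)   ∎)
  where lem : ∀ x → 4 * x + 4 * x ≡ 4 * (2 * x)
        lem = solve-∀

-- `h` is the integer part of the square root of `Q / c`, found by induction on `Q`.
scaled-√ : ∀ c Q → 1 ≤ c → ∃ λ h → c * (h * h) ≤ Q × Q < c * (suc h * suc h)
scaled-√ c zero 1≤c = 0 , ≤-reflexive (*-zeroʳ c) , ≤-trans 1≤c (≤-reflexive (sym (*-identityʳ c)))
scaled-√ c (suc Q) 1≤c with scaled-√ c Q 1≤c
... | h , lower , upper with suc Q <? c * (suc h * suc h)
...   | yes lt = h , m≤n⇒m≤1+n lower , lt
...   | no ≮ = suc h , ≮⇒≥ ≮ , (begin-strict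
          suc Q                             ≤⟨ upper ⟩
          c * (suc h * suc h)               <⟨ m<m+n _ (*-mono-≤ 1≤c (s≤s z≤n)) ⟩
          c * (suc h * suc h) + c * suc (2 * suc h) ≡⟨ lem c (suc h) ⟩
          c * (suc (suc h) * suc (suc h))   ∎)
  where lem : ∀ c x → c * (x * x) + c * suc (2 * x) ≡ c * (suc x * suc x)
        lem = solve-∀

-- Finite sums and counting

sum-mono-≤ : ∀ {n} {f g : Fin n → ℕ} → (∀ i → f i ≤ g i) → sum f ≤ sum g
sum-mono-≤ {zero} p = z≤n
sum-mono-≤ {suc n} p = +-mono-≤ (p zero) (sum-mono-≤ (p ∘ suc))

sum-const : ∀ n c → sum {n} (λ _ → c) ≡ n * c
sum-const zero c = refl
sum-const (suc n) c = cong (c +_) (sum-const n c)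

sum-*ʳ : ∀ {n} (f : Fin n → ℕ) c → sum (λ i → f i * c) ≡ sum f * c
sum-*ʳ {zero} f c = refl
sum-*ʳ {suc n} f c = trans (cong (f zero * c +_) (sum-*ʳ (f ∘ suc) c)) (sym (*-distribʳ-+ c (f zero) _))

sum-↑ : ∀ a {q} (f : Fin (a + q) → ℕ) → sum f ≡ sum (λ i → f (i ↑ˡ q)) + sum (λ j → f (a ↑ʳ j))
sum-↑ zero f = refl
sum-↑ (suc a) f = trans (cong (f zero +_) (sum-↑ a (f ∘ suc))) (sym (+-assoc (f zero) _ _))

sum-tabulate : ∀ {n} (f : Fin n → ℕ) → ListAction.sum (tabulate f) ≡ sum f
sum-tabulate {zero} f = refl
sum-tabulate {suc n} f = cong (f zero +_) (sum-tabulate (f ∘ suc))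

weight-K : ∀ a q f → weight (K a q) f ≡ sum (λ i → f (i ↑ˡ q)) + sum (λ j → f (a ↑ʳ j))
weight-K a q f = trans (cong ListAction.sum (map-tabulate id f)) (trans (sum-tabulate f) (sum-↑ a f))

indicator : ∀ {p} {P : Set p} → Dec P → ℕ
indicator (yes _) = 1
indicator (no _) = 0

indicator-cong : ∀ {p r} {P : Set p} {R : Set r} → (P → R) → (R → P) →
                 (P? : Dec P) (R? : Dec R) → indicator P? ≡ indicator R?
indicator-cong f g (yes _) (yes _) = refl
indicator-cong f g (yes p) (no ¬r) = contradiction (f p) ¬r
indicator-cong f g (no ¬p) (yes r) = contradiction (g r) ¬p
indicator-cong f g (no _) (no _) = refl

indicator-≤1 : ∀ {p} {P : Set p} (P? : Dec P) → indicator P? ≤ 1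
indicator-≤1 (yes _) = ≤-refl
indicator-≤1 (no _) = z≤n

count-≤ : ∀ {n p} {P : Fin n → Set p} (P? : ∀ i → Dec (P i)) → sum (indicator ∘ P?) ≤ n
count-≤ {n} P? = ≤-trans (sum-mono-≤ (indicator-≤1 ∘ P?)) (≤-reflexive (trans (sum-const n 1) (*-identityʳ n)))

-- Serves to distribute `m` prescribed lists over vertices whose size bound `P` is small enough;
-- `nothing` marks a vertex without a prescription.
enumerate : ∀ {n p} {P : Fin n → Set p} (P? : ∀ i → Dec (P i)) {m} → m ≤ sum (indicator ∘ P?) →
            Σ (Fin n → Maybe (Fin m)) λ g → ∀ j → ∃ λ i → P i × g i ≡ just j
enumerate {zero} P? z≤n = (λ ()) , λ ()
enumerate {suc n} P? {m} m≤ with P? zero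
... | no _ with enumerate (P? ∘ suc) m≤
...   | g , onto = (λ { zero → nothing ; (suc i) → g i }) ,
                   λ j → let (i , Pi , eq) = onto j in suc i , Pi , eq
enumerate {suc n} P? {zero} m≤ | yes _ = (λ _ → nothing) , λ ()
enumerate {suc n} P? {suc m} (s≤s m≤) | yes P0 with enumerate (P? ∘ suc) m≤
...   | g , onto = (λ { zero → just zero ; (suc i) → Maybe.map suc (g i) }) ,
                   λ { zero → zero , P0 , refl
                     ; (suc j) → let (i , Pi , eq) = onto j in suc i , Pi , cong (Maybe.map suc) eq }

-- Lower bound

∈-take⁻ : ∀ {A : Set} n (xs : List A) {x} → x ∈ take n xs → x ∈ xs
∈-take⁻ n xs = All.lookup (All.take⁺ n (All.tabulate id))

length-map-allFin : ∀ {A : Set} {n} (f : Fin n → A) → length (map f (allFin n)) ≡ n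
length-map-allFin {n = n} f = trans (length-map f (allFin n)) (length-tabulate id)

-- Lists that are too long are cut down; lists that are too short are replaced by arbitrary ones.
choosable-colouring : ∀ {G f} → Choosable G f → (M : Fin (n G) → List ℕ) → (∀ v → Unique (M v)) →
  Σ (Fin (n G) → ℕ) λ c → (∀ v → f v ≤ length (M v) → c v ∈ M v) × (∀ u v → Adj G u v → c u ≢ c v)
choosable-colouring {G} {f} choosable M M! = c , c∈M , proj₂ (proj₂ colouring)
  where
    trim : ∀ m (xs : List ℕ) → Unique xs →
           Σ (List ℕ) λ ys → Unique ys × length ys ≡ m × (m ≤ length xs → ∀ {x} → x ∈ ys → x ∈ xs)
    trim m xs xs! with m ≤? length xs
    ... | yes m≤ = take m xs , Unique.take⁺ m xs! , trans (length-take m xs) (m≤n⇒m⊓n≡m m≤) , λ _ → ∈-take⁻ m xs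
    ... | no m≰ = upTo m , Unique.upTo⁺ m , length-upTo m , λ m≤ → contradiction m≤ m≰
    trimmed = λ v → trim (f v) (M v) (M! v)
    colouring = choosable record
      { L = proj₁ ∘ trimmed
      ; uniq = proj₁ ∘ proj₂ ∘ trimmed
      ; len = proj₁ ∘ proj₂ ∘ proj₂ ∘ trimmed }
    c = proj₁ colouring
    c∈M : ∀ v → f v ≤ length (M v) → c v ∈ M v
    c∈M v le = proj₂ (proj₂ (proj₂ (trimmed v))) le (proj₁ (proj₂ colouring) v)

leftSide-↑ˡ : ∀ a q (u : Fin a) → leftSide a (u ↑ˡ q) ≡ true
leftSide-↑ˡ a q u rewrite Fin.splitAt-↑ˡ a u q = refl

leftSide-↑ʳ : ∀ a q (w : Fin q) → leftSide a (a ↑ʳ w) ≡ false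
leftSide-↑ʳ a q w rewrite Fin.splitAt-↑ʳ a q w = refl

module _ {a q} {f : Fin (a + q) → ℕ} (choosable : Choosable (K a q) f) where

  private
    fA : Fin a → ℕ
    fA u = f (u ↑ˡ q)
    fQ : Fin q → ℕ
    fQ w = f (a ↑ʳ w)

  K-colouring : (MA : Fin a → List ℕ) (MQ : Fin q → List ℕ) → (∀ u → Unique (MA u)) → (∀ w → Unique (MQ w)) →
    Σ (Fin a → ℕ) λ cA → Σ (Fin q → ℕ) λ cQ →
      (∀ u → fA u ≤ length (MA u) → cA u ∈ MA u) ×
      (∀ w → fQ w ≤ length (MQ w) → cQ w ∈ MQ w) ×
      (∀ u w → cA u ≢ cQ w)
  K-colouring MA MQ MA! MQ! =
    (λ u → c (u ↑ˡ q)) , (λ w → c (a ↑ʳ w)) , inA , inQ ,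
    λ u w → proper (u ↑ˡ q) (a ↑ʳ w) (λ eq → true≢false (trans (sym (leftSide-↑ˡ a q u)) (trans eq (leftSide-↑ʳ a q w))))
    where
      true≢false : true ≢ false
      true≢false ()
      M : Fin (a + q) → List ℕ
      M v = [ MA , MQ ]′ (splitAt a v)
      M! : ∀ v → Unique (M v)
      M! v with splitAt a v
      ... | inj₁ u = MA! u
      ... | inj₂ w = MQ! w
      colouring = choosable-colouring choosable M M!
      c = proj₁ colouring
      proper = proj₂ (proj₂ colouring)
      inA : ∀ u → fA u ≤ length (MA u) → c (u ↑ˡ q) ∈ MA u
      inA u le = subst (c (u ↑ˡ q) ∈_) eq (proj₁ (proj₂ colouring) (u ↑ˡ q) (subst (λ xs → fA u ≤ length xs) (sym eq) le))
        where eq : M (u ↑ˡ q) ≡ MA u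
              eq = cong [ MA , MQ ]′ (Fin.splitAt-↑ˡ a u q)
      inQ : ∀ w → fQ w ≤ length (MQ w) → c (a ↑ʳ w) ∈ MQ w
      inQ w le = subst (c (a ↑ʳ w) ∈_) eq (proj₁ (proj₂ colouring) (a ↑ʳ w) (subst (λ xs → fQ w ≤ length xs) (sym eq) le))
        where eq : M (a ↑ʳ w) ≡ MQ w
              eq = cong [ MA , MQ ]′ (Fin.splitAt-↑ʳ a q w)

  fQ-positive : ∀ w → 1 ≤ fQ w
  fQ-positive w with fQ w in eq
  ... | suc _ = s≤s z≤n
  -- If size 0 occurred, empty lists everywhere would force a colour out of an empty list.
  ... | zero with K-colouring (λ _ → []) (λ _ → []) (λ _ → []) (λ _ → [])
  ...   | _ , _ , _ , inQ , _ with inQ w (≤-reflexive eq)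
  ...     | ()

  -- Distinct singletons on the f = 1 vertices of the large side forbid that many colours.
  singletons<fA : ∀ u → sum (λ w → indicator (fQ w ≤? 1)) < fA u
  singletons<fA u = ≰⇒> λ le →
    let (g , onto) = enumerate (λ w → fQ w ≤? 1) ≤-refl
        (cA , cQ , inA , inQ , proper) =
          K-colouring (λ _ → map toℕ (allFin m)) (listQ ∘ g)
            (λ _ → Unique.map⁺ Fin.toℕ-injective (Unique.allFin⁺ m)) (listQ! ∘ g)
        (j , _ , cu≡) = ∈-map⁻ toℕ (inA u (≤-trans le (≤-reflexive (sym (length-map-allFin toℕ)))))
        (w , fw≤1 , gw≡) = onto j
        cw∈ = subst (λ x → fQ w ≤ length (listQ x) → cQ w ∈ listQ x) gw≡ (inQ w) fw≤1
    in proper u w (trans cu≡ (sym (∈-singleton cw∈)))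
    where
      m = sum (λ w → indicator (fQ w ≤? 1))
      listQ : Maybe (Fin m) → List ℕ
      listQ = maybe′ (λ j → toℕ j ∷ []) []
      listQ! : ∀ x → Unique (listQ x)
      listQ! nothing = []
      listQ! (just _) = [] ∷ []
      ∈-singleton : ∀ {x y : ℕ} → x ∈ y ∷ [] → x ≡ y
      ∈-singleton (here eq) = eq

  -- Take t disjoint copies of K_{h,h} as the lists of the large side, and on the small side the 2ᵗ
  -- unions of one half from each copy.  The colours used on the small side miss a half of every
  -- copy, hence miss the union of these halves, which is one of the lists.
  few-short-lists : ∀ t h → t * (h * h) ≤ sum (λ w → indicator (fQ w ≤? 2)) →
                    sum (λ u → indicator (fA u ≤? t * h)) < 2 ^ t
  few-short-lists t h edges≤ = ≰⇒> λ lists≤ →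
    let (gA , ontoA) = enumerate (λ u → fA u ≤? t * h) lists≤
        (gQ , ontoQ) = enumerate (λ w → fQ w ≤? 2) edges≤
        (cA , cQ , inA , inQ , proper) = K-colouring (listA ∘ gA) (listQ ∘ gQ) (listA! ∘ gA) (listQ! ∘ gQ)
    in impossible gA ontoA gQ ontoQ cA cQ inA inQ proper
    where
      -- Vertex `k` in half `b` of copy `i`; `combine` keeps distinct triples apart.
      colour : Fin t → Fin 2 → Fin h → ℕ
      colour i b k = toℕ (combine (combine i b) k)
      colour-inj : ∀ {i b k i′ b′ k′} → colour i b k ≡ colour i′ b′ k′ → i ≡ i′ × b ≡ b′ × k ≡ k′
      colour-inj {i} {b} {k} {i′} {b′} {k′} eq =
        let (eq₁ , eq₂) = Fin.combine-injective (combine i b) k (combine i′ b′) k′ (Fin.toℕ-injective eq)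
            (eq₃ , eq₄) = Fin.combine-injective i b i′ b′ eq₁
        in eq₃ , eq₄ , eq₂
      halves : (Fin t → Fin 2) → List ℕ
      halves ε = map (λ x → let (i , k) = remQuot {t} h x in colour i (ε i) k) (allFin (t * h))
      halves! : ∀ ε → Unique (halves ε)
      halves! ε = Unique.map⁺ inj (Unique.allFin⁺ _)
        where
          inj : ∀ {x y : Fin (t * h)} → _ → x ≡ y
          inj {x} {y} eq = trans (sym (Fin.combine-remQuot {t} h x)) (trans
            (cong₂ combine (proj₁ (colour-inj eq)) (proj₂ (proj₂ (colour-inj eq)))) (Fin.combine-remQuot {t} h y))
      edge : Fin t × Fin (h * h) → List ℕ
      edge (i , e) = let (k , k′) = remQuot {h} h e in colour i zero k ∷ colour i (suc zero) k′ ∷ []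
      edge! : ∀ e → Unique (edge e)
      edge! (i , e) = ((λ eq → 0≢1 (proj₁ (proj₂ (colour-inj eq)))) ∷ []) ∷ [] ∷ []
        where 0≢1 : zero ≢ Fin.suc {n = 1} zero
              0≢1 ()
      -- `finToFun` reads an index below `2 ^ t` as a choice of one half in each copy.
      listA : Maybe (Fin (2 ^ t)) → List ℕ
      listA = maybe′ (λ j → halves (finToFun j)) []
      listQ : Maybe (Fin (t * (h * h))) → List ℕ
      listQ = maybe′ (λ j → edge (remQuot (h * h) j)) []
      listQ-combine : ∀ i k k′ → listQ (just (combine i (combine k k′))) ≡ colour i zero k ∷ colour i (suc zero) k′ ∷ []
      listQ-combine i k k′ = trans (cong edge (Fin.remQuot-combine {t} i (combine k k′)))
        (cong (λ (k , k′) → colour i zero k ∷ colour i (suc zero) k′ ∷ []) (Fin.remQuot-combine {h} k k′))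
      listA! : ∀ x → Unique (listA x)
      listA! (just j) = halves! (finToFun j)
      listA! nothing = []
      listQ! : ∀ x → Unique (listQ x)
      listQ! (just j) = edge! (remQuot (h * h) j)
      listQ! nothing = []
      impossible : (gA : Fin a → Maybe (Fin (2 ^ t))) → (∀ j → ∃ λ u → fA u ≤ t * h × gA u ≡ just j) →
                   (gQ : Fin q → Maybe (Fin (t * (h * h)))) → (∀ j → ∃ λ w → fQ w ≤ 2 × gQ w ≡ just j) →
                   (cA : Fin a → ℕ) (cQ : Fin q → ℕ) →
                   (∀ u → fA u ≤ length (listA (gA u)) → cA u ∈ listA (gA u)) →
                   (∀ w → fQ w ≤ length (listQ (gQ w)) → cQ w ∈ listQ (gQ w)) →
                   (∀ u w → cA u ≢ cQ w) → ⊥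
      impossible gA ontoA gQ ontoQ cA cQ inA inQ proper = contra
        where
          -- These two colours form the list of some vertex `w` of the large side, and either choice
          -- at `w` repeats a colour of a neighbour.
          independent : ∀ i k k′ u u′ → cA u ≡ colour i zero k → cA u′ ≢ colour i (suc zero) k′
          independent i k k′ u u′ eq eq′ with ontoQ (combine i (combine k k′))
          ... | w , fw≤2 , gw≡ with subst (λ xs → fQ w ≤ length xs → cQ w ∈ xs) (trans (cong listQ gw≡) (listQ-combine i k k′)) (inQ w) fw≤2
          ...   | here e = proper u w (trans eq (sym e))
          ...   | there (here e) = proper u′ w (trans eq′ (sym e))
          used? : ∀ i → Dec (∃ λ k → ∃ λ u → cA u ≡ colour i zero k)
          used? i = Fin.any? λ k → Fin.any? λ u → cA u ≟ colour i zero k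
          missed : ∀ i → ∃ λ b → ∀ k u → cA u ≢ colour i b k
          missed i with used? i
          ... | yes (k , u , eq) = suc zero , λ k′ u′ → independent i k k′ u u′ eq
          ... | no unused = zero , λ k u eq → unused (k , u , eq)
          ε : Fin t → Fin 2
          ε = proj₁ ∘ missed
          contra : ⊥
          contra with ontoA (funToFin ε)
          ... | u , fu≤ , gu≡ with ∈-map⁻ _ (subst (λ xs → fA u ≤ length xs → cA u ∈ xs) (cong listA gu≡) (inA u)
                    (≤-trans fu≤ (≤-reflexive (sym (length-map-allFin _)))))
          ...   | x , _ , eq = proj₂ (missed i) k u (trans eq (cong (λ b → colour i b k) (Fin.finToFun-funToFin ε i)))
            where i = proj₁ (remQuot {t} h x)
                  k = proj₂ (remQuot {t} h x)

-- Accounting for the excess over 2q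

module _ {a q} {f : Fin (a + q) → ℕ} (2≤a : 2 ≤ a) (choosable : Choosable (K a q) f) where

  private
    fA : Fin a → ℕ
    fA u = f (u ↑ˡ q)
    fQ : Fin q → ℕ
    fQ w = f (a ↑ʳ w)
    ΣA = sum fA
    ΣQ = sum fQ
    q₁ = sum (λ w → indicator (fQ w ≤? 1))
    q₂ = sum (λ w → indicator (fQ w ≤? 2))

  -- A list of size 1 falls two short of 3 and is counted in both `q₁` and `q₂`; one of size 2 falls
  -- one short and is counted in `q₂` only.
  3q≤ΣQ+q₁+q₂ : q * 3 ≤ ΣQ + q₁ + q₂
  3q≤ΣQ+q₁+q₂ = begin
    q * 3                          ≡⟨ sym (sum-const q 3) ⟩
    sum {q} (λ _ → 3)              ≤⟨ sum-mono-≤ (λ w → 3≤ (fQ w) (fQ-positive choosable w)) ⟩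
    sum (λ w → fQ w + indicator (fQ w ≤? 1) + indicator (fQ w ≤? 2)) ≡⟨ ∑-distrib-+ {q} _ _ ⟩
    sum (λ w → fQ w + indicator (fQ w ≤? 1)) + q₂ ≡⟨ cong (_+ q₂) (∑-distrib-+ {q} _ _) ⟩
    ΣQ + q₁ + q₂ ∎
    where
      3≤ : ∀ m → 1 ≤ m → 3 ≤ m + indicator (m ≤? 1) + indicator (m ≤? 2)
      3≤ (suc zero) _ = ≤-refl
      3≤ (suc (suc zero)) _ = ≤-refl
      3≤ (suc (suc (suc m))) _ = s≤s (s≤s (s≤s z≤n))

  -- Every singleton costs at least one unit on each of at least two vertices of the small side, so
  -- half of `ΣA` pays for what the singletons save.
  2q₁≤ΣA : 2 * q₁ ≤ ΣA
  2q₁≤ΣA = begin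
    2 * q₁            ≤⟨ *-monoˡ-≤ q₁ 2≤a ⟩
    a * q₁            ≡⟨ sym (sum-const a q₁) ⟩
    sum {a} (λ _ → q₁) ≤⟨ sum-mono-≤ (λ u → <⇒≤ (singletons<fA choosable u)) ⟩
    ΣA                ∎

  -- Half of `ΣA` cancels the savings `q₁`. The remaining excess over `2 * q` is at least `ΣA / 2`
  -- plus `q - q₂`, the number of lists of size at least 3 on the large side; doubling avoids
  -- fractions.
  6q+ΣA≤2weight+2q₂ : 6 * q + ΣA ≤ 2 * weight (K a q) f + 2 * q₂
  6q+ΣA≤2weight+2q₂ = +-cancelʳ-≤ (2 * q₁) _ _ (begin
    6 * q + ΣA + 2 * q₁              ≤⟨ +-monoʳ-≤ (6 * q + ΣA) 2q₁≤ΣA ⟩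
    6 * q + ΣA + ΣA                  ≡⟨ lem₁ q ΣA ⟩
    2 * ΣA + 2 * (q * 3)             ≤⟨ +-monoʳ-≤ (2 * ΣA) (*-monoʳ-≤ 2 3q≤ΣQ+q₁+q₂) ⟩
    2 * ΣA + 2 * (ΣQ + q₁ + q₂)      ≡⟨ lem₂ ΣA ΣQ q₁ q₂ ⟩
    2 * (ΣA + ΣQ) + 2 * q₂ + 2 * q₁  ≡⟨ cong (λ s → 2 * s + 2 * q₂ + 2 * q₁) (sym (weight-K a q f)) ⟩
    2 * weight (K a q) f + 2 * q₂ + 2 * q₁ ∎)
    where
      lem₁ : ∀ q x → 6 * q + x + x ≡ 2 * x + 2 * (q * 3)
      lem₁ = solve-∀
      lem₂ : ∀ x y u v → 2 * x + 2 * (y + u + v) ≡ 2 * (x + y) + 2 * v + 2 * u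
      lem₂ = solve-∀

  4q+ΣA≤2weight : 4 * q + ΣA ≤ 2 * weight (K a q) f
  4q+ΣA≤2weight = +-cancelʳ-≤ (2 * q) _ _ (begin
    4 * q + ΣA + 2 * q   ≡⟨ lem q ΣA ⟩
    6 * q + ΣA           ≤⟨ 6q+ΣA≤2weight+2q₂ ⟩
    2 * weight (K a q) f + 2 * q₂ ≤⟨ +-monoʳ-≤ (2 * weight (K a q) f) (*-monoʳ-≤ 2 (count-≤ (λ w → fQ w ≤? 2))) ⟩
    2 * weight (K a q) f + 2 * q ∎)
    where lem : ∀ q x → 4 * q + x + 2 * q ≡ 6 * q + x
          lem = solve-∀

  2q≤weight : 2 * q ≤ weight (K a q) f
  2q≤weight = *-cancelˡ-≤ 2 (begin
    2 * (2 * q)  ≡⟨ sym (*-assoc 2 2 q) ⟩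
    4 * q        ≤⟨ m≤m+n (4 * q) ΣA ⟩
    4 * q + ΣA   ≤⟨ 4q+ΣA≤2weight ⟩
    2 * weight (K a q) f ∎)

  private
    D = weight (K a q) f ∸ 2 * q

    2weight≡ : 2 * weight (K a q) f ≡ 4 * q + 2 * D
    2weight≡ = trans (cong (2 *_) (sym (m+[n∸m]≡n 2q≤weight))) (lem q D)
      where lem : ∀ q d → 2 * (2 * q + d) ≡ 4 * q + 2 * d
            lem = solve-∀

  ΣA≤2excess : ΣA ≤ 2 * D
  ΣA≤2excess = +-cancelˡ-≤ (4 * q) _ _ (≤-trans 4q+ΣA≤2weight (≤-reflexive 2weight≡))

  few-pairs⇒q≤2excess : 2 * q₂ ≤ q → q ≤ 2 * D
  few-pairs⇒q≤2excess 2q₂≤q = +-cancelˡ-≤ (4 * q) _ _ (+-cancelʳ-≤ q _ _ (begin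
    4 * q + q + q             ≡⟨ lem q ⟩
    6 * q                     ≤⟨ m≤m+n (6 * q) ΣA ⟩
    6 * q + ΣA                ≤⟨ 6q+ΣA≤2weight+2q₂ ⟩
    2 * weight (K a q) f + 2 * q₂ ≤⟨ +-mono-≤ (≤-reflexive 2weight≡) 2q₂≤q ⟩
    4 * q + 2 * D + q ∎))
    where lem : ∀ q → 4 * q + q + q ≡ 6 * q
          lem = solve-∀

  -- A Markov count: at most half of the lists on the small side have size at most `t * h`, and each
  -- of the others contributes at least `suc (t * h)`.
  short-lists⇒ΣA : ∀ t h → 2 * 2 ^ t ≤ a + 2 → t * (h * h) ≤ q₂ → a * suc (t * h) ≤ 2 * ΣA
  short-lists⇒ΣA t h 2^t≤ edges≤ = +-cancelʳ-≤ (a * x) _ _ (begin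
    a * x + a * x          ≡⟨ lem₁ (a * x) ⟩
    2 * (a * x)            ≤⟨ *-monoʳ-≤ 2 ax≤ ⟩
    2 * (ΣA + p * x)       ≡⟨ lem₂ ΣA p x ⟩
    2 * ΣA + 2 * p * x     ≤⟨ +-monoʳ-≤ (2 * ΣA) (*-monoˡ-≤ x 2p≤a) ⟩
    2 * ΣA + a * x         ∎)
    where
      x = suc (t * h)
      p = sum (λ u → indicator (fA u ≤? t * h))
      x≤ : ∀ m (m≤? : Dec (m ≤ t * h)) → x ≤ m + indicator m≤? * x
      x≤ m (yes _) = ≤-trans (≤-reflexive (sym (*-identityˡ x))) (m≤n+m (1 * x) m)
      x≤ m (no m≰) = ≤-trans (≰⇒> m≰) (m≤m+n m _)
      ax≤ : a * x ≤ ΣA + p * x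
      ax≤ = begin
        a * x                 ≡⟨ sym (sum-const a x) ⟩
        sum {a} (λ _ → x)     ≤⟨ sum-mono-≤ (λ u → x≤ (fA u) (fA u ≤? t * h)) ⟩
        sum (λ u → fA u + indicator (fA u ≤? t * h) * x) ≡⟨ ∑-distrib-+ {a} _ _ ⟩
        ΣA + sum (λ u → indicator (fA u ≤? t * h) * x)   ≡⟨ cong (ΣA +_) (sum-*ʳ {a} _ x) ⟩
        ΣA + p * x            ∎
      2p≤a : 2 * p ≤ a
      -- The strict bound `p < 2 ^ t` supplies the 2 that the slack in `a + 2` had given away.
      2p≤a = +-cancelʳ-≤ 2 (2 * p) a (begin
        2 * p + 2     ≡⟨ lem₃ p ⟩
        2 * suc p     ≤⟨ *-monoʳ-≤ 2 (few-short-lists choosable t h edges≤) ⟩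
        2 * 2 ^ t     ≤⟨ 2^t≤ ⟩
        a + 2         ∎)
        where lem₃ : ∀ p → 2 * p + 2 ≡ 2 * suc p
              lem₃ = solve-∀
      lem₁ : ∀ x → x + x ≡ 2 * x
      lem₁ = solve-∀
      lem₂ : ∀ s p x → 2 * (s + p * x) ≡ 2 * s + 2 * p * x
      lem₂ = solve-∀

  -- Either at least half of the large side has lists of size at least 3, or enough pairs are
  -- available for the disjoint complete bipartite graphs. The factor `3 * t` stands for an upper
  -- bound on the binary logarithm of `a`.
  excess-lower : ∀ t → 1 ≤ t → 2 * 2 ^ t ≤ a + 2 → 2 * t ≤ q →
                 q ≤ 2 * D ⊎ 3 * t * (a * a * q) ≤ 384 * D ^ 2
  excess-lower t 1≤t 2^t≤ 2t≤q with 2 * q₂ ≤? q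
  ... | yes few = inj₁ (few-pairs⇒q≤2excess few)
  -- Dividing by `2 * t` makes `t * (h * h)` at most `q / 2`, hence at most `q₂`.
  ... | no many with scaled-√ (2 * t) q (≤-trans 1≤t (m≤m+n t _))
  ...   | h , lower , upper = inj₂ (begin
    3 * t * (a * a * q)                       ≤⟨ *-monoʳ-≤ (3 * t) (*-monoʳ-≤ (a * a) (<⇒≤ upper)) ⟩
    3 * t * (a * a * (2 * t * (suc h * suc h)))     ≡⟨ lem₁ t a (suc h) ⟩
    6 * (a * (t * suc h) * (a * (t * suc h)))       ≤⟨ *-monoʳ-≤ 6 (*-mono-≤ at≤8D at≤8D) ⟩
    6 * (8 * D * (8 * D))                     ≡⟨ lem₂ D ⟩
    384 * (D * (D * 1))                       ∎)
    where
      lem₁ : ∀ t a h → 3 * t * (a * a * (2 * t * (h * h))) ≡ 6 * (a * (t * h) * (a * (t * h)))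
      lem₁ = solve-∀
      lem₂ : ∀ d → 6 * (8 * d * (8 * d)) ≡ 384 * (d * (d * 1))
      lem₂ = solve-∀
      -- With `h ≥ 1` the rounded-up `t * suc h` is at most `2 * t * h`, so rounding loses only a
      -- constant factor.
      h-positive : ∀ h → q < 2 * t * (suc h * suc h) → 1 ≤ h
      h-positive zero q< = contradiction (≤-trans q< (≤-reflexive (*-identityʳ (2 * t)))) (≤⇒≯ 2t≤q)
      h-positive (suc h) _ = s≤s z≤n
      edges≤ : t * (h * h) ≤ q₂
      edges≤ = *-cancelˡ-≤ 2 (begin
        2 * (t * (h * h))  ≡⟨ sym (*-assoc 2 t _) ⟩
        2 * t * (h * h)    ≤⟨ lower ⟩
        q                  ≤⟨ <⇒≤ (≰⇒> many) ⟩
        2 * q₂             ∎)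
      at≤8D : a * (t * suc h) ≤ 8 * D
      at≤8D = begin
        a * (t * suc h)           ≡⟨ cong (a *_) (*-suc t h) ⟩
        a * (t + t * h)           ≤⟨ *-monoʳ-≤ a (+-monoˡ-≤ (t * h) (≤-trans (≤-reflexive (sym (*-identityʳ t))) (*-monoʳ-≤ t (h-positive h upper)))) ⟩
        a * (t * h + t * h)       ≤⟨ *-monoʳ-≤ a (+-mono-≤ (n≤1+n (t * h)) (n≤1+n (t * h))) ⟩
        a * (suc (t * h) + suc (t * h)) ≡⟨ lem₃ a (suc (t * h)) ⟩
        2 * (a * suc (t * h))     ≤⟨ *-monoʳ-≤ 2 (short-lists⇒ΣA t h 2^t≤ edges≤) ⟩
        2 * (2 * ΣA)              ≤⟨ *-monoʳ-≤ 2 (*-monoʳ-≤ 2 ΣA≤2excess) ⟩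
        2 * (2 * (2 * D))         ≡⟨ lem₄ D ⟩
        8 * D                     ∎
        where
          lem₃ : ∀ a x → a * (x + x) ≡ 2 * (a * x)
          lem₃ = solve-∀
          lem₄ : ∀ d → 2 * (2 * (2 * d)) ≡ 8 * d
          lem₄ = solve-∀

-- Greedy independent transversals

occurrences : ℕ → List ℕ → ℕ
occurrences x [] = 0
occurrences x (y ∷ ys) = indicator (x ≟ y) + occurrences x ys

occurrences-++ : ∀ x ys zs → occurrences x (ys ++ zs) ≡ occurrences x ys + occurrences x zs
occurrences-++ x [] zs = refl
occurrences-++ x (y ∷ ys) zs = trans (cong (indicator (x ≟ y) +_) (occurrences-++ x ys zs)) (sym (+-assoc (indicator (x ≟ y)) _ _))

∉⇒occurrences≡0 : ∀ {x ys} → x ∉ ys → occurrences x ys ≡ 0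
∉⇒occurrences≡0 {x} {[]} _ = refl
∉⇒occurrences≡0 {x} {y ∷ ys} x∉ with x ≟ y
... | yes eq = contradiction (here eq) x∉
... | no _ = ∉⇒occurrences≡0 {x} {ys} (x∉ ∘ there)

Unique⇒occurrences≤1 : ∀ x {ys} → Unique ys → occurrences x ys ≤ 1
Unique⇒occurrences≤1 x [] = z≤n
Unique⇒occurrences≤1 x {y ∷ ys} ys!@(_ ∷ ys′!) with x ≟ y
... | yes refl = ≤-reflexive (cong suc (∉⇒occurrences≡0 (Unique.Unique[x∷xs]⇒x∉xs ys!)))
... | no _ = Unique⇒occurrences≤1 x ys′!

occurrences-concat : ∀ x {Ls} → All Unique Ls → occurrences x (concat Ls) ≤ length (filter (x ∈?_) Ls)
occurrences-concat x [] = z≤n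
occurrences-concat x {L ∷ Ls} (L! ∷ Ls!) with x ∈? L
... | yes _ = ≤-trans (≤-reflexive (occurrences-++ x L (concat Ls))) (+-mono-≤ (Unique⇒occurrences≤1 x L!) (occurrences-concat x Ls!))
... | no x∉ = ≤-trans (≤-reflexive (trans (occurrences-++ x L (concat Ls)) (cong (_+ occurrences x (concat Ls)) (∉⇒occurrences≡0 x∉)))) (occurrences-concat x Ls!)

sum-toℕ≡-suc : ∀ n z → sum {n} (λ i → indicator (suc (toℕ i) ≟ suc z)) ≡ sum {n} (λ i → indicator (toℕ i ≟ z))
sum-toℕ≡-suc n z = sum-cong-≗ {n} λ i → indicator-cong suc-injective (cong suc) (suc (toℕ i) ≟ suc z) (toℕ i ≟ z)

sum-toℕ≡-≤1 : ∀ n z → sum {n} (λ i → indicator (toℕ i ≟ z)) ≤ 1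
sum-toℕ≡-≤1 zero z = z≤n
sum-toℕ≡-≤1 (suc n) zero = s≤s (≤-reflexive (trans (sum-const n 0) (*-zeroʳ n)))
sum-toℕ≡-≤1 (suc n) (suc z) = ≤-trans (≤-reflexive (sum-toℕ≡-suc n z)) (sum-toℕ≡-≤1 n z)

sum-toℕ≡-≥1 : ∀ {n z} → z < n → 1 ≤ sum {n} (λ i → indicator (toℕ i ≟ z))
sum-toℕ≡-≥1 {suc n} {zero} _ = s≤s z≤n
sum-toℕ≡-≥1 {suc n} {suc z} (s≤s z<n) = ≤-trans (sum-toℕ≡-≥1 z<n) (≤-reflexive (sym (sum-toℕ≡-suc n z)))

sum-occurrences-≤ : ∀ n zs → sum {n} (λ i → occurrences (toℕ i) zs) ≤ length zs
sum-occurrences-≤ n [] = ≤-reflexive (trans (sum-const n 0) (*-zeroʳ n))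
sum-occurrences-≤ n (z ∷ zs) = ≤-trans (≤-reflexive (∑-distrib-+ {n} _ _)) (+-mono-≤ (sum-toℕ≡-≤1 n z) (sum-occurrences-≤ n zs))

sum-occurrences-≥ : ∀ {n zs} → All (_< n) zs → length zs ≤ sum {n} (λ i → occurrences (toℕ i) zs)
sum-occurrences-≥ [] = z≤n
sum-occurrences-≥ {n} (z< ∷ zs<) = ≤-trans (+-mono-≤ (sum-toℕ≡-≥1 z<) (sum-occurrences-≥ zs<)) (≤-reflexive (sym (∑-distrib-+ {n} _ _)))

sum-<⇒∃< : ∀ {n} (f g : Fin n → ℕ) → sum f < sum g → ∃ λ i → f i < g i
sum-<⇒∃< {suc n} f g lt with f zero <? g zero
... | yes f<g = zero , f<g
... | no f≮g with sum-<⇒∃< (f ∘ suc) (g ∘ suc) (+-cancelˡ-< (f zero) _ _ (<-≤-trans lt (+-monoˡ-≤ _ (≮⇒≥ f≮g))))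
...   | i , f<g = suc i , f<g

∃-bound : ∀ zs → ∃ λ n → All (_< n) zs
∃-bound zs = suc (ListAction.sum zs) , go zs
  where
    go : ∀ zs → All (_< suc (ListAction.sum zs)) zs
    go [] = []
    go (z ∷ zs) = s≤s (m≤m+n z _) ∷ All.map (λ z< → ≤-trans z< (s≤s (m≤n+m (ListAction.sum zs) z))) (go zs)

-- Summing over colours below a bound for `zs` counts all of `zs` and at most all of `ws`, so the
-- strict inequality of the totals holds at some single colour.
occurrences-averaging : ∀ ws zs α β → length ws * α < length zs * β →
                        ∃ λ x → occurrences x ws * α < occurrences x zs * β
occurrences-averaging ws zs α β lt with ∃-bound zs
... | n , zs< with sum-<⇒∃< {n} (λ i → occurrences (toℕ i) ws * α) (λ i → occurrences (toℕ i) zs * β) (begin-strict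
        sum {n} (λ i → occurrences (toℕ i) ws * α) ≡⟨ sum-*ʳ {n} _ α ⟩
        sum {n} (λ i → occurrences (toℕ i) ws) * α ≤⟨ *-monoˡ-≤ α (sum-occurrences-≤ n ws) ⟩
        length ws * α                              <⟨ lt ⟩
        length zs * β                              ≤⟨ *-monoˡ-≤ β (sum-occurrences-≥ zs<) ⟩
        sum {n} (λ i → occurrences (toℕ i) zs) * β ≡⟨ sym (sum-*ʳ {n} _ β) ⟩
        sum {n} (λ i → occurrences (toℕ i) zs * β) ∎)
...   | i , x< = toℕ i , x<

-- Deleting the neighbours of a colour

≢? : ∀ y z → Dec (y ≢ z)
≢? y z = ¬? (y ≟ z)

remove : List ℕ → List ℕ → List ℕ
remove [] xs = xs
remove (y ∷ ys) xs = filter (≢? y) (remove ys xs)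

remove! : ∀ ys {xs} → Unique xs → Unique (remove ys xs)
remove! [] xs! = xs!
remove! (y ∷ ys) xs! = Unique.filter⁺ (≢? y) (remove! ys xs!)

∈-remove⁻ : ∀ ys {xs z} → z ∈ remove ys xs → z ∈ xs × z ∉ ys
∈-remove⁻ [] z∈ = z∈ , λ ()
∈-remove⁻ (y ∷ ys) {xs} z∈ with ∈-filter⁻ (≢? y) {xs = remove ys xs} z∈
... | z∈′ , y≢z with ∈-remove⁻ ys z∈′
...   | z∈xs , z∉ys = z∈xs , λ { (here eq) → y≢z (sym eq) ; (there z∈ys) → z∉ys z∈ys }

length-filter-≢ : ∀ y {xs} → Unique xs → length xs ≤ suc (length (filter (≢? y) xs))
length-filter-≢ y [] = z≤n
length-filter-≢ y {x ∷ xs} (x∉ ∷ xs!) with y ≟ x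
... | yes refl = s≤s (≤-reflexive (cong length (sym (trans (filter-reject (≢? y) {y} (λ y≢y → y≢y refl)) (filter-all (≢? y) x∉)))))
... | no y≢x = ≤-trans (s≤s (length-filter-≢ y xs!)) (≤-reflexive (cong (suc ∘ length) (sym (filter-accept (≢? y) y≢x))))

length-remove : ∀ ys {xs} → Unique xs → length xs ≤ length (remove ys xs) + length ys
length-remove [] xs! = m≤m+n _ 0
length-remove (y ∷ ys) {xs} xs! = begin
  length xs                                        ≤⟨ length-remove ys xs! ⟩
  length (remove ys xs) + length ys                ≤⟨ +-monoˡ-≤ _ (length-filter-≢ y (remove! ys xs!)) ⟩
  suc (length (remove (y ∷ ys) xs)) + length ys    ≡⟨ sym (+-suc _ _) ⟩
  length (remove (y ∷ ys) xs) + suc (length ys)    ∎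

length-filter-∁ : ∀ {A : Set} {P : A → Set} (P? : ∀ x → Dec (P x)) xs →
                  length (filter (¬? ∘ P?) xs) + length (filter P? xs) ≡ length xs
length-filter-∁ P? [] = refl
length-filter-∁ P? (x ∷ xs) with P? x
... | yes _ = trans (+-suc _ _) (cong suc (length-filter-∁ P? xs))
... | no _ = cong suc (length-filter-∁ P? xs)

neighbours : List (ℕ × ℕ) → ℕ → List ℕ
neighbours R x = map proj₂ (filter (λ e → x ≟ proj₁ e) R)

∈-neighbours : ∀ {R x y} → (x , y) ∈ R → y ∈ neighbours R x
∈-neighbours {x = x} xy∈ = ∈-map⁺ proj₂ (∈-filter⁺ (λ e → x ≟ proj₁ e) xy∈ refl)

length-neighbours : ∀ R x → length (neighbours R x) ≡ occurrences x (map proj₁ R)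
length-neighbours R x = trans (length-map proj₂ (filter (λ e → x ≟ proj₁ e) R)) (go R)
  where
    go : ∀ R → length (filter (λ e → x ≟ proj₁ e) R) ≡ occurrences x (map proj₁ R)
    go [] = refl
    go (e ∷ R) with x ≟ proj₁ e
    ... | yes x≡ = trans (cong length (filter-accept (λ e → x ≟ proj₁ e) {e} {R} x≡)) (cong suc (go R))
    ... | no x≢ = trans (cong length (filter-reject (λ e → x ≟ proj₁ e) {e} {R} x≢)) (go R)

length-concat-≥ : ∀ {Ls : List (List ℕ)} {r} → All (λ L → r ≤ length L) Ls → length Ls * r ≤ length (concat Ls)
length-concat-≥ [] = z≤n
length-concat-≥ {L ∷ Ls} (r≤ ∷ rest) = ≤-trans (+-mono-≤ r≤ (length-concat-≥ rest)) (≤-reflexive (sym (length-++ L)))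

-- Harmonic, because a greedy step satisfying d of j lists deletes at most dB/j colours from the others.
needed : (r₀ B j : ℕ) → ℕ
needed r₀ B zero = r₀
needed r₀ B (suc j) = needed r₀ B j + suc (B / suc j)

module _ (r₀ B : ℕ) where

  needed-≥ : ∀ j → r₀ ≤ needed r₀ B j
  needed-≥ zero = ≤-refl
  needed-≥ (suc j) = ≤-trans (needed-≥ j) (m≤m+n _ _)

  -- The increments of `needed` shrink with the index, so up to index `a` each is at least
  -- `suc (B / a)`.
  needed-+-≥ : ∀ e k {a} .{{_ : NonZero a}} → e + k ≤ a → needed r₀ B e + k * suc (B / a) ≤ needed r₀ B (e + k)
  needed-+-≥ e zero _ = ≤-reflexive (trans (+-identityʳ _) (cong (needed r₀ B) (sym (+-identityʳ e))))
  needed-+-≥ e (suc k) {a} le = begin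
    needed r₀ B e + (s + k * s)      ≡⟨ lem (needed r₀ B e) s (k * s) ⟩
    needed r₀ B e + k * s + s        ≤⟨ +-mono-≤ (needed-+-≥ e k (≤-trans (n≤1+n (e + k)) le′)) (s≤s (/-monoʳ-≤ B le′)) ⟩
    needed r₀ B (suc (e + k))        ≡⟨ cong (needed r₀ B) (sym (+-suc e k)) ⟩
    needed r₀ B (e + suc k)          ∎
    where
      s = suc (B / a)
      le′ : suc (e + k) ≤ a
      le′ = ≤-trans (≤-reflexive (sym (+-suc e k))) le
      lem : ∀ x y z → x + (y + z) ≡ x + z + y
      lem = solve-∀

  -- The budget of one greedy step: `d` of `e + d` lists are hit and `δ` colours are deleted from
  -- the other `e`. The last `d` increments of `needed` cover `δ`.
  needed-drop : ∀ e d δ → δ * (e + d) < d * B → needed r₀ B e + δ ≤ needed r₀ B (e + d)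
  needed-drop e (suc d) δ lt = ≤-trans (+-monoʳ-≤ (needed r₀ B e) (*-cancelʳ-≤ δ _ a (begin
      δ * a                        ≤⟨ <⇒≤ lt ⟩
      suc d * B                    ≤⟨ *-monoʳ-≤ (suc d) B≤ ⟩
      suc d * (suc (B / a) * a)    ≡⟨ sym (*-assoc (suc d) (suc (B / a)) a) ⟩
      suc d * suc (B / a) * a      ∎)))
    (needed-+-≥ e (suc d) ≤-refl)
    where
      a = e + suc d
      instance
        a≢0 : NonZero a
        a≢0 = >-nonZero (≤-trans (s≤s z≤n) (m≤n+m (suc d) e))
      -- The `suc` in each increment of `needed` compensates for the rounding down of the quotient.
      B≤ : B ≤ suc (B / a) * a
      B≤ = ≤-trans (≤-reflexive (m≡m%n+[m/n]*n B a)) (+-monoˡ-≤ _ (<⇒≤ (m%n<n B a)))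

  needed-+-≤ : ∀ e j → needed r₀ B (e + j) ≤ needed r₀ B e + j + j * (B / suc e)
  needed-+-≤ e zero = ≤-reflexive (trans (cong (needed r₀ B) (+-identityʳ e)) (sym (trans (+-identityʳ _) (+-identityʳ _))))
  needed-+-≤ e (suc j) = begin
    needed r₀ B (e + suc j)                     ≡⟨ cong (needed r₀ B) (+-suc e j) ⟩
    needed r₀ B (e + j) + suc (B / suc (e + j)) ≤⟨ +-mono-≤ (needed-+-≤ e j) (s≤s (/-monoʳ-≤ B (s≤s (m≤m+n e j)))) ⟩
    needed r₀ B e + j + j * b + suc b           ≡⟨ lem (needed r₀ B e) j (j * b) b ⟩
    needed r₀ B e + suc j + (b + j * b)         ∎
    where
      b = B / suc e
      lem : ∀ x j y b → x + j + y + suc b ≡ x + suc j + (b + y)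
      lem = solve-∀

  -- The dyadic estimate of the harmonic sum: a block of indices from `2 ^ m` to below `2 ^ suc m`
  -- has at most `2 ^ m` quotients, each at most `B / 2 ^ m`, so it adds at most `B`.
  needed-≤ : ∀ m k → k < 2 ^ m → needed r₀ B k ≤ r₀ + k + B * m
  needed-≤ zero zero _ = ≤-trans (m≤m+n r₀ 0) (m≤m+n (r₀ + 0) _)
  needed-≤ zero (suc k) (s≤s ())
  needed-≤ (suc m) k k< with k <? 2 ^ m
  ... | yes k<2^m = ≤-trans (needed-≤ m k k<2^m) (+-monoʳ-≤ (r₀ + k) (*-monoʳ-≤ B (n≤1+n m)))
  ... | no k≮2^m = begin
    needed r₀ B k                           ≡⟨ cong (needed r₀ B) (sym e+j≡k) ⟩
    needed r₀ B (e + j)                     ≤⟨ needed-+-≤ e j ⟩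
    needed r₀ B e + j + j * (B / suc e)     ≤⟨ +-mono-≤ (+-monoˡ-≤ j (needed-≤ m e e<)) (≤-trans (*-monoˡ-≤ _ j≤) (≤-trans (≤-reflexive (*-comm (suc e) _)) (m/n*n≤m B (suc e)))) ⟩
    r₀ + e + B * m + j + B                  ≡⟨ lem r₀ e B m j ⟩
    r₀ + (e + j) + B * suc m                ≡⟨ cong (λ k → r₀ + k + B * suc m) e+j≡k ⟩
    r₀ + k + B * suc m                      ∎
    where
      -- The last index before the block, so that the block starts at `suc e`, which is `2 ^ m`.
      e = pred (2 ^ m)
      suc-e : suc e ≡ 2 ^ m
      suc-e = suc-pred (2 ^ m) {{m^n≢0 2 m}}
      e< : e < 2 ^ m
      e< = ≤-reflexive suc-e
      j = k ∸ e
      e+j≡k : e + j ≡ k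
      e+j≡k = m+[n∸m]≡n (≤-trans (<⇒≤ e<) (≮⇒≥ k≮2^m))
      j≤ : j ≤ suc e
      j≤ = +-cancelˡ-≤ e j (suc e) (s≤s⁻¹ (begin
        suc (e + j)       ≡⟨ cong suc e+j≡k ⟩
        suc k             ≤⟨ k< ⟩
        2 ^ m + (2 ^ m + 0) ≡⟨ cong (2 ^ m +_) (+-identityʳ (2 ^ m)) ⟩
        2 ^ m + 2 ^ m     ≡⟨ cong₂ _+_ (sym suc-e) (sym suc-e) ⟩
        suc e + suc e ∎))
      lem : ∀ r e B m j → r + e + B * m + j + B ≡ r + (e + j) + B * suc m
      lem = solve-∀

module _ (R : List (ℕ × ℕ)) (R-sym : ∀ {x y} → (x , y) ∈ R → (y , x) ∈ R) (R-irrefl : ∀ {x} → (x , x) ∉ R)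
         (r₀ B : ℕ) (R< : length R < B * r₀) where

  private
    instance
      r₀≢0 : NonZero r₀
      r₀≢0 = ≢-nonZero λ { refl → contradiction (≤-trans R< (≤-reflexive (*-zeroʳ B))) λ () }

  -- Averages the degree of a colour against the number of lists containing it.
  efficient-colour : ∀ Ls → All Unique Ls → All (λ L → r₀ ≤ length L) Ls → 1 ≤ length Ls →
    ∃ λ x → length (neighbours R x) * length Ls < length (filter (x ∈?_) Ls) * B
  -- The weight `suc (length R)` makes the comparison of totals strict, and `R<` still bounds it by
  -- `B * r₀`.
  efficient-colour Ls Ls! r₀≤ 1≤a with occurrences-averaging (map proj₁ R) (concat Ls) (a * r₀) (suc (length R)) (begin-strict
      length (map proj₁ R) * (a * r₀)   ≡⟨ cong (_* (a * r₀)) (length-map proj₁ R) ⟩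
      length R * (a * r₀)               <⟨ m<n+m _ (*-mono-≤ 1≤a (>-nonZero⁻¹ r₀)) ⟩
      suc (length R) * (a * r₀)         ≡⟨ *-comm (suc (length R)) (a * r₀) ⟩
      a * r₀ * suc (length R)           ≤⟨ *-monoˡ-≤ (suc (length R)) (length-concat-≥ r₀≤) ⟩
      length (concat Ls) * suc (length R) ∎)
    where a = length Ls
  ... | x , lt = x , *-cancelʳ-< r₀ _ _ (begin-strict
      length (neighbours R x) * a * r₀              ≡⟨ *-assoc (length (neighbours R x)) a r₀ ⟩
      length (neighbours R x) * (a * r₀)            ≡⟨ cong (_* (a * r₀)) (length-neighbours R x) ⟩
      occurrences x (map proj₁ R) * (a * r₀)        <⟨ lt ⟩
      occurrences x (concat Ls) * suc (length R)    ≤⟨ *-mono-≤ (occurrences-concat x Ls!) R< ⟩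
      length (filter (x ∈?_) Ls) * (B * r₀)         ≡⟨ sym (*-assoc (length (filter (x ∈?_) Ls)) B r₀) ⟩
      length (filter (x ∈?_) Ls) * B * r₀           ∎)
    where a = length Ls

  -- The second clause carries the induction: a colour of `C` comes from some list, so once the
  -- neighbours of a colour are deleted from all lists, `C` contains none of them.
  IndependentTransversal : List (List ℕ) → Set
  IndependentTransversal Ls = Σ (List ℕ) λ C →
    (∀ {L} → L ∈ Ls → ∃ λ x → x ∈ C × x ∈ L) ×
    (∀ {x} → x ∈ C → ∃ λ L → L ∈ Ls × x ∈ L) ×
    (∀ {x y} → (x , y) ∈ R → x ∈ C → y ∉ C)

  -- Take an efficient colour, drop the lists it hits, delete its neighbours from the others and
  -- recurse. The bound `m` makes the recursion structural.
  independent-transversal : ∀ m Ls → length Ls ≤ m → All Unique Ls →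
    All (λ L → needed r₀ B (length Ls) ≤ length L) Ls → IndependentTransversal Ls
  independent-transversal m [] _ _ _ = [] , (λ ()) , (λ ()) , λ _ ()
  independent-transversal (suc m) Ls@(_ ∷ _) (s≤s len≤) Ls! big =
    extend (efficient-colour Ls Ls! (All.map (≤-trans (needed-≥ r₀ B (length Ls))) big) (s≤s z≤n))
    where
      extend : (∃ λ x → length (neighbours R x) * length Ls < length (filter (x ∈?_) Ls) * B) → IndependentTransversal Ls
      extend (x , efficient) = x ∷ C , hits , from , independent
        where
            N = neighbours R x
            hit = filter (x ∈?_) Ls
            rest = filter (¬? ∘ (x ∈?_)) Ls
            Ls′ = map (remove N) rest
            rest+hit : length rest + length hit ≡ length Ls
            rest+hit = length-filter-∁ (x ∈?_) Ls
            -- Strictness of the efficiency inequality forces a hit: the number of lists decreases,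
            -- and the chosen colour lies in one of them.
            hit-nonempty : ∀ {hs : List (List ℕ)} {k} → k < length hs * B → 1 ≤ length hs
            hit-nonempty {_ ∷ _} _ = s≤s z≤n
            some-hit : ∃ λ L → L ∈ hit
            some-hit with hit | hit-nonempty {hit} efficient
            ... | L ∷ _ | _ = L , here refl
            len′≤ : length Ls′ ≤ m
            len′≤ = s≤s⁻¹ (begin
              suc (length Ls′)           ≡⟨ cong suc (length-map (remove N) rest) ⟩
              suc (length rest)          ≡⟨ +-comm 1 (length rest) ⟩
              length rest + 1            ≤⟨ +-monoʳ-≤ (length rest) (hit-nonempty {hit} efficient) ⟩
              length rest + length hit   ≡⟨ rest+hit ⟩
              length Ls                  ≤⟨ s≤s len≤ ⟩
              suc m ∎)
            Ls′! : All Unique Ls′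
            Ls′! = All.map⁺ (All.map (remove! N) (All.filter⁺ (¬? ∘ (x ∈?_)) Ls!))
            drop : needed r₀ B (length rest) + length N ≤ needed r₀ B (length Ls)
            drop = ≤-trans (needed-drop r₀ B (length rest) (length hit) (length N) (subst (λ a → length N * a < length hit * B) (sym rest+hit) efficient))
                           (≤-reflexive (cong (needed r₀ B) rest+hit))
            remove-big : ∀ {L} → Unique L × needed r₀ B (length Ls) ≤ length L → needed r₀ B (length Ls′) ≤ length (remove N L)
            remove-big {L} (L! , L-big) = +-cancelʳ-≤ (length N) _ _ (begin
              needed r₀ B (length Ls′) + length N   ≡⟨ cong (λ k → needed r₀ B k + length N) (length-map (remove N) rest) ⟩
              needed r₀ B (length rest) + length N  ≤⟨ drop ⟩
              needed r₀ B (length Ls)               ≤⟨ L-big ⟩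
              length L                              ≤⟨ length-remove N L! ⟩
              length (remove N L) + length N        ∎)
            big′ : All (λ L → needed r₀ B (length Ls′) ≤ length L) Ls′
            big′ = All.map⁺ (All.map remove-big (All.filter⁺ (¬? ∘ (x ∈?_)) (All.zip (Ls! , big))))
            recursive = independent-transversal m Ls′ len′≤ Ls′! big′
            C = proj₁ recursive
            hits : ∀ {L} → L ∈ Ls → ∃ λ y → y ∈ x ∷ C × y ∈ L
            hits {L} L∈ with x ∈? L
            ... | yes x∈L = x , here refl , x∈L
            ... | no x∉L with proj₁ (proj₂ recursive) (∈-map⁺ (remove N) (∈-filter⁺ (¬? ∘ (x ∈?_)) L∈ x∉L))
            ...   | y , y∈C , y∈L = y , there y∈C , proj₁ (∈-remove⁻ N y∈L)
            origin : ∀ {y} → y ∈ C → ∃ λ L → L ∈ Ls × y ∈ L × y ∉ N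
            origin y∈C with proj₁ (proj₂ (proj₂ recursive)) y∈C
            ... | L′ , L′∈ , y∈ with ∈-map⁻ (remove N) L′∈
            ...   | L , L∈ , refl = L , proj₁ (∈-filter⁻ (¬? ∘ (x ∈?_)) {xs = Ls} L∈) , ∈-remove⁻ N y∈
            from : ∀ {y} → y ∈ x ∷ C → ∃ λ L → L ∈ Ls × y ∈ L
            from (here refl) with some-hit
            ... | L , L∈ = L , ∈-filter⁻ (x ∈?_) {xs = Ls} L∈
            from (there y∈C) with origin y∈C
            ... | L , L∈ , y∈L , _ = L , L∈ , y∈L
            apart : ∀ {y} → (x , y) ∈ R → y ∉ C
            apart xy∈ y∈C = proj₂ (proj₂ (proj₂ (origin y∈C))) (∈-neighbours xy∈)
            independent : ∀ {y z} → (y , z) ∈ R → y ∈ x ∷ C → z ∉ x ∷ C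
            independent yz∈ (here refl) (here refl) = R-irrefl yz∈
            independent yz∈ (here refl) (there z∈C) = apart yz∈ z∈C
            independent yz∈ (there y∈C) (here refl) = apart (R-sym yz∈) y∈C
            independent yz∈ (there y∈C) (there z∈C) = proj₂ (proj₂ (proj₂ recursive)) yz∈ y∈C z∈C

-- Colouring the bipartite graph from an independent transversal

sizes : (a q r : ℕ) → Fin (a + q) → ℕ
sizes a q r v = [ (λ _ → r) , (λ _ → 2) ]′ (splitAt a v)

weight-sizes : ∀ a q r → weight (K a q) (sizes a q r) ≡ 2 * q + a * r
weight-sizes a q r = trans (weight-K a q (sizes a q r)) (trans
  (cong₂ _+_
    (trans (sum-cong-≗ {a} (λ u → cong [ (λ _ → r) , (λ _ → 2) ]′ (Fin.splitAt-↑ˡ a u q))) (sum-const a r))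
    (trans (sum-cong-≗ {q} (λ w → cong [ (λ _ → r) , (λ _ → 2) ]′ (Fin.splitAt-↑ʳ a q w))) (sum-const q 2)))
  (lem q (a * r)))
  where
    lem : ∀ q x → x + q * 2 ≡ 2 * q + x
    lem = solve-∀

pair-view : ∀ {xs : List ℕ} → Unique xs → length xs ≡ 2 → Σ (ℕ × ℕ) λ (x , y) → x ≢ y × x ∈ xs × y ∈ xs
pair-view {x ∷ y ∷ []} ((x≢y ∷ []) ∷ _) refl = (x , y) , x≢y , here refl , there (here refl)

-- The small side is coloured from an independent set `C` meeting all its lists; no pair on the
-- large side lies inside `C`, so each has a colour outside it. The term `2 * q` arises because `R`
-- holds every pair in both orders.
K-choosable : ∀ a q r r₀ B → suc (2 * q) ≤ B * r₀ → needed r₀ B a ≤ r → Choosable (K a q) (sizes a q r)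
K-choosable a q r r₀ B q< needed≤ A = proj₁ ∘ pick , proj₁ ∘ proj₂ ∘ pick , proper
  where
    Ls = tabulate (λ u → L A (u ↑ˡ q))
    pairs : ∀ w → Σ (ℕ × ℕ) λ (x , y) → x ≢ y × x ∈ L A (a ↑ʳ w) × y ∈ L A (a ↑ʳ w)
    pairs w = pair-view (uniq A (a ↑ʳ w)) (trans (len A (a ↑ʳ w)) (cong [ (λ _ → r) , (λ _ → 2) ]′ (Fin.splitAt-↑ʳ a q w)))
    E = tabulate (proj₁ ∘ pairs)
    R = E ++ map swap E
    R-sym : ∀ {x y} → (x , y) ∈ R → (y , x) ∈ R
    R-sym xy∈ with ∈-++⁻ E xy∈
    ... | inj₁ xy∈E = ∈-++⁺ʳ E (∈-map⁺ swap xy∈E)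
    ... | inj₂ xy∈E′ with ∈-map⁻ swap xy∈E′
    ...   | _ , yx∈E , refl = ∈-++⁺ˡ yx∈E
    E-irrefl : ∀ {x} → (x , x) ∉ E
    E-irrefl xx∈ with ∈-tabulate⁻ xx∈
    ... | w , eq = proj₁ (proj₂ (pairs w)) (trans (sym (cong proj₁ eq)) (cong proj₂ eq))
    R-irrefl : ∀ {x} → (x , x) ∉ R
    R-irrefl xx∈ with ∈-++⁻ E xx∈
    ... | inj₁ xx∈E = E-irrefl xx∈E
    ... | inj₂ xx∈E′ with ∈-map⁻ swap xx∈E′
    ...   | _ , xx∈E , refl = E-irrefl xx∈E
    length-R : length R ≡ 2 * q
    length-R = trans (length-++ E) (cong₂ _+_ length-E (trans (length-map swap E) (trans length-E (sym (+-identityʳ q)))))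
      where length-E = length-tabulate (proj₁ ∘ pairs)
    length-Ls : length Ls ≡ a
    length-Ls = length-tabulate (λ u → L A (u ↑ˡ q))
    big : ∀ u → needed r₀ B (length Ls) ≤ length (L A (u ↑ˡ q))
    big u = begin
      needed r₀ B (length Ls) ≡⟨ cong (needed r₀ B) length-Ls ⟩
      needed r₀ B a           ≤⟨ needed≤ ⟩
      r                       ≡⟨ sym (trans (len A (u ↑ˡ q)) (cong [ (λ _ → r) , (λ _ → 2) ]′ (Fin.splitAt-↑ˡ a u q))) ⟩
      length (L A (u ↑ˡ q))   ∎
    transversal = independent-transversal R R-sym R-irrefl r₀ B (subst (_< B * r₀) (sym length-R) q<)
      (length Ls) Ls ≤-refl (All.tabulate⁺ (λ u → uniq A (u ↑ˡ q))) (All.tabulate⁺ big)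
    C = proj₁ transversal
    pickQ : ∀ w → ∃ λ c → c ∈ L A (a ↑ʳ w) × c ∉ C
    pickQ w with pairs w in eq
    ... | (x , y) , _ , x∈ , y∈ with x ∈? C
    ...   | yes x∈C = y , y∈ , proj₂ (proj₂ (proj₂ transversal))
                        (∈-++⁺ˡ (subst (_∈ E) (cong proj₁ eq) (∈-tabulate⁺ {f = proj₁ ∘ pairs} w))) x∈C
    ...   | no x∉C = x , x∈ , x∉C
    -- The side of `v` is recorded with the colour, so that adjacent vertices differ by membership
    -- in `C`.
    pick : ∀ v → ∃ λ c → c ∈ L A v × ((leftSide a v ≡ true × c ∈ C) ⊎ (leftSide a v ≡ false × c ∉ C))
    pick v with splitAt a v in eq
    ... | inj₁ u with Fin.splitAt⁻¹-↑ˡ {a} {q} {v} eq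
    ...   | refl with proj₁ (proj₂ transversal) (∈-tabulate⁺ {f = λ u → L A (u ↑ˡ q)} u)
    ...     | c , c∈C , c∈ = c , c∈ , inj₁ (refl , c∈C)
    pick v | inj₂ w with Fin.splitAt⁻¹-↑ʳ {a} {q} {v} eq
    ...   | refl with pickQ w
    ...     | c , c∈ , c∉C = c , c∈ , inj₂ (refl , c∉C)
    proper : ∀ u v → leftSide a u ≢ leftSide a v → proj₁ (pick u) ≢ proj₁ (pick v)
    proper u v adj eq with proj₂ (proj₂ (pick u)) | proj₂ (proj₂ (pick v))
    ... | inj₁ (lu , _) | inj₁ (lv , _) = adj (trans lu (sym lv))
    ... | inj₂ (lu , _) | inj₂ (lv , _) = adj (trans lu (sym lv))
    ... | inj₁ (_ , u∈) | inj₂ (_ , v∉) = v∉ (subst (_∈ C) eq u∈)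
    ... | inj₂ (_ , u∉) | inj₁ (_ , v∈) = u∉ (subst (_∈ C) (sym eq) v∈)

-- Choice of parameters

n≤2^n : ∀ n → n ≤ 2 ^ n
n≤2^n zero = z≤n
n≤2^n (suc n) = ≤-trans (+-mono-≤ (m^n>0 2 n) (n≤2^n n)) (+-monoʳ-≤ (2 ^ n) (m≤m+n (2 ^ n) 0))

^-cancelʳ-≤ : ∀ m {x y} → 1 < m → m ^ x ≤ m ^ y → x ≤ y
^-cancelʳ-≤ m 1<m le = ≮⇒≥ λ y<x → <⇒≱ (^-monoʳ-< m 1<m y<x) le

*-self-cancel-≤ : ∀ m n → m * m ≤ n * n → m ≤ n
*-self-cancel-≤ m n le = ≮⇒≥ λ n<m → <⇒≱ (*-mono-< n<m n<m) le

t+2≤3t : ∀ {t} → 1 ≤ t → t + 2 ≤ 3 * t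
t+2≤3t {t} 1≤t = begin
  t + 2 * 1 ≤⟨ +-monoʳ-≤ t (*-monoʳ-≤ 2 1≤t) ⟩
  t + 2 * t ∎

4*2^t≡2^[t+2] : ∀ t → 4 * 2 ^ t ≡ 2 ^ (t + 2)
4*2^t≡2^[t+2] t = trans (*-comm 4 (2 ^ t)) (sym (^-distribˡ-+-* 2 t 2))

-- With `N` about the square root of `q / t`, the choice `r₀ = N * t` and `B = 3 * N` balances the
-- base requirement against the harmonic cost `B * (t + 2)`.
choosable-sizes : ∀ {a q t} → 1 ≤ t → a < 4 * 2 ^ t → a * a ≤ q → t ≤ q →
  ∃ λ r → Choosable (K a q) (sizes a q r) × r * r ≤ 484 * (q * t)
choosable-sizes {a} {q} {t} 1≤t a< a²≤q t≤q with scaled-√ t q 1≤t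
... | h , lower , upper = r , K-choosable a q r (N * t) (3 * N) q< needed≤ , r²≤
  where
    N = suc h
    -- One `N * t` for `r₀`, one for `a`, and nine for `3 * N * (t + 2)`, since `t + 2 ≤ 3 * t`.
    r = 11 * (N * t)
    q< : suc (2 * q) ≤ 3 * N * (N * t)
    q< = begin
      suc (2 * q)              ≤⟨ s≤s (m≤n+m (2 * q) (2 + q)) ⟩
      suc (2 + q + 2 * q)      ≡⟨ lem₁ q ⟩
      3 * suc q                ≤⟨ *-monoʳ-≤ 3 upper ⟩
      3 * (t * (N * N))        ≡⟨ lem₂ t N ⟩
      3 * N * (N * t)          ∎
      where
        lem₁ : ∀ q → suc (2 + q + 2 * q) ≡ 3 * suc q
        lem₁ = solve-∀
        lem₂ : ∀ t N → 3 * (t * (N * N)) ≡ 3 * N * (N * t)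
        lem₂ = solve-∀
    a≤Nt : a ≤ N * t
    a≤Nt = *-self-cancel-≤ a (N * t) (begin
      a * a                    ≤⟨ a²≤q ⟩
      q                        ≤⟨ <⇒≤ upper ⟩
      t * (N * N)              ≤⟨ *-monoˡ-≤ (N * N) (≤-trans (≤-reflexive (sym (*-identityʳ t))) (*-monoʳ-≤ t 1≤t)) ⟩
      t * t * (N * N)          ≡⟨ lem t N ⟩
      N * t * (N * t)          ∎)
      where lem : ∀ t N → t * t * (N * N) ≡ N * t * (N * t)
            lem = solve-∀
    needed≤ : needed (N * t) (3 * N) a ≤ r
    needed≤ = begin
      needed (N * t) (3 * N) a           ≤⟨ needed-≤ (N * t) (3 * N) (t + 2) a (subst (a <_) (4*2^t≡2^[t+2] t) a<) ⟩
      N * t + a + 3 * N * (t + 2)        ≤⟨ +-mono-≤ (+-monoʳ-≤ (N * t) a≤Nt) (*-monoʳ-≤ (3 * N) (t+2≤3t 1≤t)) ⟩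
      N * t + N * t + 3 * N * (3 * t)    ≡⟨ lem N t ⟩
      11 * (N * t)                       ∎
      where lem : ∀ N t → N * t + N * t + 3 * N * (3 * t) ≡ 11 * (N * t)
            lem = solve-∀
    h-positive : ∀ h → q < t * (suc h * suc h) → 1 ≤ h
    h-positive zero q<t = contradiction (≤-trans q<t (≤-reflexive (*-identityʳ t))) (≤⇒≯ t≤q)
    h-positive (suc h) _ = s≤s z≤n
    N≤2h : N ≤ 2 * h
    N≤2h = begin
      1 + h        ≤⟨ +-monoˡ-≤ h (h-positive h upper) ⟩
      h + h        ≡⟨ cong (h +_) (sym (+-identityʳ h)) ⟩
      2 * h        ∎
    r²≤ : r * r ≤ 484 * (q * t)
    r²≤ = begin
      11 * (N * t) * (11 * (N * t))   ≡⟨ lem₁ 11 N t ⟩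
      -- Replacing `N` by `2 * h` costs a factor 4, whence 484.
      121 * t * (t * (N * N))         ≤⟨ *-monoʳ-≤ (121 * t) (*-monoʳ-≤ t (*-mono-≤ N≤2h N≤2h)) ⟩
      121 * t * (t * (2 * h * (2 * h))) ≡⟨ lem₂ 121 t h ⟩
      484 * (t * (h * h) * t)         ≤⟨ *-monoʳ-≤ 484 (*-monoˡ-≤ t lower) ⟩
      484 * (q * t)                   ∎
      where
        lem₁ : ∀ c N t → c * (N * t) * (c * (N * t)) ≡ c * c * t * (t * (N * N))
        lem₁ = solve-∀
        lem₂ : ∀ c t h → c * t * (t * (2 * h * (2 * h))) ≡ c * 4 * (t * (h * h) * t)
        lem₂ = solve-∀

-- The two bounds in exponential form

module _ {a q : ℕ} (2≤a : 2 ≤ a) (a^≤ : a ^ (4 * (a * a)) ≤ 2 ^ (2 * q)) where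

  private
    instance
      a≢0 : NonZero a
      a≢0 = >-nonZero (<⇒≤ 2≤a)
    t = proj₁ (dyadic a 2≤a)
    1≤t = proj₁ (proj₂ (dyadic a 2≤a))
    2^t≤ = proj₁ (proj₂ (proj₂ (dyadic a 2≤a)))
    a<4*2^t = proj₂ (proj₂ (proj₂ (dyadic a 2≤a)))

    2^t≤a : 2 ^ t ≤ a
    2^t≤a = *-cancelˡ-≤ 2 (begin
      2 * 2 ^ t   ≤⟨ 2^t≤ ⟩
      a + 2       ≤⟨ +-monoʳ-≤ a 2≤a ⟩
      a + a       ≡⟨ cong (a +_) (sym (+-identityʳ a)) ⟩
      2 * a       ∎)

    a≤2^3t : a ≤ 2 ^ (3 * t)
    a≤2^3t = begin
      a            ≤⟨ <⇒≤ a<4*2^t ⟩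
      4 * 2 ^ t    ≡⟨ 4*2^t≡2^[t+2] t ⟩
      2 ^ (t + 2)  ≤⟨ ^-monoʳ-≤ 2 (t+2≤3t 1≤t) ⟩
      2 ^ (3 * t)  ∎

    2a²≤q : 2 * (a * a) ≤ q
    -- Lowering the base `a` to 2 in the hypothesis leaves powers of 2, whose exponents can be
    -- compared.
    2a²≤q = *-cancelˡ-≤ 2 (≤-trans (≤-reflexive (sym (*-assoc 2 2 (a * a))))
      (^-cancelʳ-≤ 2 (s≤s (s≤s z≤n)) (≤-trans (^-monoˡ-≤ (4 * (a * a)) 2≤a) a^≤)))

    t≤a² : t ≤ a * a
    t≤a² = ≤-trans (n≤2^n t) (≤-trans 2^t≤a (m≤m*n a a))

    a²≤q : a * a ≤ q
    a²≤q = ≤-trans (m≤m+n (a * a) _) 2a²≤q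

  lower-bound : ∀ {f} → Choosable (K a q) f →
    (a ^ (1 * (a * a * q))) ≤exp (768 * (weight (K a q) f ∸ 2 * q) ^ 2)
  -- `768 = 2 * 384`: passing from `2 ^ x` to the exponential doubles the exponent.
  lower-bound {f} choosable = subst ((a ^ (1 * (a * a * q))) ≤exp_) (sym (*-assoc 2 384 (D ^ 2))) (≤2^⇒≤exp {x = 384 * D ^ 2}
    (subst (λ x → a ^ x ≤ 2 ^ (384 * D ^ 2)) (sym (*-identityˡ (a * a * q)))
      ([ when-q≤2D , when-product ]′ (excess-lower 2≤a choosable t 1≤t 2^t≤ (≤-trans (*-monoʳ-≤ 2 t≤a²) 2a²≤q)))))
    where
      D = weight (K a q) f ∸ 2 * q
      -- The hypothesis on `q`, raised to the power `q`, bounds the left side by `2 ^ (2 * q * q)`,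
      -- and `q * q` is at most `4 * (D * D)`.
      when-q≤2D : q ≤ 2 * D → a ^ (a * a * q) ≤ 2 ^ (384 * D ^ 2)
      when-q≤2D q≤2D = begin
        a ^ (a * a * q)          ≤⟨ ^-monoʳ-≤ a (*-monoˡ-≤ q (m≤m+n (a * a) _)) ⟩
        a ^ (4 * (a * a) * q)    ≡⟨ sym (^-*-assoc a (4 * (a * a)) q) ⟩
        (a ^ (4 * (a * a))) ^ q  ≤⟨ ^-monoˡ-≤ q a^≤ ⟩
        (2 ^ (2 * q)) ^ q        ≡⟨ ^-*-assoc 2 (2 * q) q ⟩
        2 ^ (2 * q * q)          ≤⟨ ^-monoʳ-≤ 2 2q²≤ ⟩
        2 ^ (384 * D ^ 2)        ∎
        where
          2q²≤ : 2 * q * q ≤ 384 * D ^ 2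
          2q²≤ = begin
            2 * q * q              ≤⟨ *-mono-≤ (*-monoʳ-≤ 2 q≤2D) q≤2D ⟩
            2 * (2 * D) * (2 * D)  ≡⟨ lem D ⟩
            8 * (D * (D * 1))      ≤⟨ *-monoˡ-≤ (D ^ 2) (m≤m+n 8 376) ⟩
            384 * D ^ 2            ∎
            where lem : ∀ d → 2 * (2 * d) * (2 * d) ≡ 8 * (d * (d * 1))
                  lem = solve-∀
      when-product : 3 * t * (a * a * q) ≤ 384 * D ^ 2 → a ^ (a * a * q) ≤ 2 ^ (384 * D ^ 2)
      when-product le = begin
        a ^ (a * a * q)             ≤⟨ ^-monoˡ-≤ (a * a * q) a≤2^3t ⟩
        (2 ^ (3 * t)) ^ (a * a * q) ≡⟨ ^-*-assoc 2 (3 * t) (a * a * q) ⟩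
        2 ^ (3 * t * (a * a * q))   ≤⟨ ^-monoʳ-≤ 2 le ⟩
        2 ^ (384 * D ^ 2)           ∎

  upper-bound : ∀ {s} → (∀ f → Choosable (K a q) f → s ≤ weight (K a q) f) →
    exp (1 * (s ∸ 2 * q) ^ 2) ≤ (a ^ (968 * (a * a * q)))
  -- `968 = 2 * 484`, the 2 coming from `e ≤ 4`; the factor `t` in the exponent is traded for the
  -- base through `2 ^ t ≤ a`.
  upper-bound {s} minimal = 2^≤⇒exp≤ (begin
    2 ^ (2 * (1 * D ^ 2))           ≤⟨ ^-monoʳ-≤ 2 2D²≤ ⟩
    2 ^ (t * (968 * (a * a * q)))   ≡⟨ sym (^-*-assoc 2 t (968 * (a * a * q))) ⟩
    (2 ^ t) ^ (968 * (a * a * q))   ≤⟨ ^-monoˡ-≤ (968 * (a * a * q)) 2^t≤a ⟩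
    a ^ (968 * (a * a * q))         ∎)
    where
      D = s ∸ 2 * q
      sizing = choosable-sizes 1≤t a<4*2^t a²≤q (≤-trans t≤a² a²≤q)
      r = proj₁ sizing
      choosable = proj₁ (proj₂ sizing)
      r²≤ = proj₂ (proj₂ sizing)
      D≤ : D ≤ a * r
      D≤ = m≤n+o⇒m∸n≤o s (2 * q) (≤-trans (minimal _ choosable) (≤-reflexive (weight-sizes a q r)))
      2D²≤ : 2 * (1 * D ^ 2) ≤ t * (968 * (a * a * q))
      2D²≤ = begin
        2 * (1 * (D * (D * 1)))    ≡⟨ lem₁ D ⟩
        2 * (D * D)                ≤⟨ *-monoʳ-≤ 2 (*-mono-≤ D≤ D≤) ⟩
        2 * (a * r * (a * r))      ≡⟨ lem₂ a r ⟩
        2 * (a * a) * (r * r)      ≤⟨ *-monoʳ-≤ (2 * (a * a)) r²≤ ⟩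
        2 * (a * a) * (484 * (q * t)) ≡⟨ lem₃ 484 a q t ⟩
        t * (968 * (a * a * q))    ∎
        where
          lem₁ : ∀ d → 2 * (1 * (d * (d * 1))) ≡ 2 * (d * d)
          lem₁ = solve-∀
          lem₂ : ∀ a r → 2 * (a * r * (a * r)) ≡ 2 * (a * a) * (r * r)
          lem₂ = solve-∀
          lem₃ : ∀ c a q t → 2 * (a * a) * (c * (q * t)) ≡ t * (c * 2 * (a * a * q))
          lem₃ = solve-∀

theorem2p1 : ∃ λ n₁ → ∃ λ d₁ → ∃ λ n₂ → ∃ λ d₂ →
    ∀ a q → 2 ≤ a → (a ^ (4 * (a * a))) ≤exp q →
    ∀ s → IsSumChoiceNumber (K a q) s →
    (2 * q ≤ s × (a ^ (suc n₁ * (a * a * q))) ≤exp (suc d₁ * ((s ∸ 2 * q) ^ 2)))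
    × exp (suc d₂ * ((s ∸ 2 * q) ^ 2)) ≤ (a ^ (suc n₂ * (a * a * q)))
-- The squares of the two constants are `1 / 768` and 968. The lower bound applies to an optimal
-- `f`, the upper one to the minimality of its weight.
theorem2p1 = 0 , 767 , 967 , 0 , λ where
  a q 2≤a a^≤ .(weight (K a q) f) ((f , choosable , refl) , minimal) →
    (2q≤weight 2≤a choosable , lower-bound 2≤a (≤exp⇒≤2^ a^≤) choosable) , upper-bound 2≤a (≤exp⇒≤2^ a^≤) minimal
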